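{- Let $m\ge 1$, let $M\in\Lambda_{2m}^m$ and let $C$ be a critical set of $M$. Then there is a defining set $D$ for $M$ such that $D\subseteq M\setminus C$ and $|D|\le 4m^2-2m-|C|$.
   Context: $\Lambda_{n}^{x}$ is the set of $n\times n$ $(0,1)$-matrices with every row sum and every column sum equal to $x$. A matrix $M$ is identified with the set of triples $\{(i,j,M_{ij})\}$. A subset $D\subseteq M$ is a defining set for $M$ if $M$ is the unique element of $\Lambda_{2m}^m$ containing $D$; a critical set is a defining set none of whose proper subsets is a defining set. The size of such a set is its number of triples. -}

module Defs where

open import Data.Nat using (ℕ; zero; suc; _+_; _*_)
open import Data.Bool using (Bool; true; false)
open import Data.Fin using (Fin; zero; suc)
open import Data.Product using (_×_)
open import Relation.Binary.PropositionalEquality using (_≡_)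
open import Relation.Nullary using (¬_)

bit : Bool → ℕ
bit true  = 1
bit false = 0

sumFin : {n : ℕ} → (Fin n → ℕ) → ℕ
sumFin {zero}  f = 0
sumFin {suc n} f = f zero + sumFin (λ i → f (suc i))

Matrix : ℕ → Set
Matrix n = Fin n → Fin n → Bool

rowSum : {n : ℕ} → Matrix n → Fin n → ℕ
rowSum M i = sumFin (λ j → bit (M i j))

colSum : {n : ℕ} → Matrix n → Fin n → ℕ
colSum M j = sumFin (λ i → bit (M i j))

InΛ : (n x : ℕ) → Matrix n → Set
InΛ n x M = (∀ i → rowSum M i ≡ x) × (∀ j → colSum M j ≡ x)

-- A subset of M (viewed as the set of triples (i,j,M i j)) is determined by
-- the set of its positions; we represent it by a position mask S:
-- the subset is {(i,j,M i j) | S i j ≡ true}.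
Mask : ℕ → Set
Mask n = Fin n → Fin n → Bool

size : {n : ℕ} → Mask n → ℕ
size S = sumFin (λ i → sumFin (λ j → bit (S i j)))

_⊆ₘ_ : {n : ℕ} → Mask n → Mask n → Set
S ⊆ₘ T = ∀ i j → S i j ≡ true → T i j ≡ true

_⊂ₘ_ : {n : ℕ} → Mask n → Mask n → Set
S ⊂ₘ T = (S ⊆ₘ T) × ¬ (∀ i j → S i j ≡ T i j)

-- S and T disjoint (so the subset S lies in M \ T)
Disjoint : {n : ℕ} → Mask n → Mask n → Set
Disjoint S T = ∀ i j → S i j ≡ true → T i j ≡ false

Contains : {n : ℕ} → Matrix n → Matrix n → Mask n → Set
Contains N M S = ∀ i j → S i j ≡ true → N i j ≡ M i j

DefiningSet : (m : ℕ) → Matrix (2 * m) → Mask (2 * m) → Set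
DefiningSet m M S =
  InΛ (2 * m) m M ×
  (∀ (N : Matrix (2 * m)) → InΛ (2 * m) m N → Contains N M S → ∀ i j → N i j ≡ M i j)

CriticalSet : (m : ℕ) → Matrix (2 * m) → Mask (2 * m) → Set
CriticalSet m M C =
  DefiningSet m M C × (∀ (S : Mask (2 * m)) → S ⊂ₘ C → ¬ DefiningSet m M S)

{-# OPTIONS --safe #-}
-- Read a 1 in cell (i , j) as an arc from row i to column j and a 0 as an arc
-- from column j to row i, so that M orients a complete bipartite graph.  The
-- difference of two matrices with equal margins is a balanced set of arcs, so S
-- determines M exactly when the arcs outside S form an acyclic graph.
--
-- Let C be critical and let the level of a vertex be the length of a longest
-- walk of arcs outside C that ends there.  If an arc u → v of C did not drop by
-- at least two levels, u could be moved before v without reversing any arc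
-- outside C, and C minus that arc would still determine M.  Hence the vertices
-- of level 0 all lie on one side, and each vertex w on the other side has an
-- in-arc outside C from exactly one level below.  Choosing one for every such w
-- yields a set T of n arcs disjoint from C, and C ∪ T is acyclic because
-- 2 · level + 3 · [tail side of T] decreases along it.  The complement of C ∪ T
-- is the required set.
module Submission where

open import Defs
open import Data.Nat using (ℕ; zero; suc; _+_; _*_; _∸_; _≤_; _≥_; _<_; z≤n; s≤s; s≤s⁻¹)
open import Data.Nat.Properties
open import Data.Nat.Tactic.RingSolver using (solve-∀)
open import Data.Bool using (Bool; true; false; not; _∧_; _∨_; if_then_else_)
import Data.Bool.Properties as Bool
open import Data.Fin using (Fin; zero; suc; toℕ; join; splitAt)
import Data.Fin.Properties as Fin
open import Data.Sum using (_⊎_; inj₁; inj₂)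
open import Data.Sum.Properties using (≡-dec; inj₁-injective; inj₂-injective)
open import Data.Product using (Σ; ∃; ∃₂; _×_; _,_; proj₁; proj₂)
open import Data.Unit using (⊤; tt)
open import Data.Empty using (⊥; ⊥-elim)
open import Function using (_∘_; Injective)
open import Relation.Nullary using (¬_; Dec; yes; no; does; contradiction)
open import Relation.Nullary.Decidable using (_×-dec_; _⊎-dec_; ¬?; map′; decidable-stable; dec-true)
open import Relation.Binary using (Decidable)
import Relation.Unary as U
open import Relation.Binary.PropositionalEquality

-- Booleans and decidable propositions

does-sound : ∀ {A : Set} (a? : Dec A) → does a? ≡ true → A
does-sound (yes a) _ = a

true≢false : ∀ {b} → b ≡ true → b ≡ false → ⊥
true≢false refl ()

bit-injective : ∀ a b → bit a ≡ bit b → a ≡ b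
bit-injective true  true  _ = refl
bit-injective false false _ = refl

bit≤1 : ∀ b → bit b ≤ 1
bit≤1 true  = ≤-refl
bit≤1 false = z≤n

-- Finite sums

sumFin-cong : ∀ {n} {f g : Fin n → ℕ} → (∀ i → f i ≡ g i) → sumFin f ≡ sumFin g
sumFin-cong {zero}  eq = refl
sumFin-cong {suc n} eq = cong₂ _+_ (eq zero) (sumFin-cong (eq ∘ suc))

sumFin-mono-≤ : ∀ {n} {f g : Fin n → ℕ} → (∀ i → f i ≤ g i) → sumFin f ≤ sumFin g
sumFin-mono-≤ {zero}  le = z≤n
sumFin-mono-≤ {suc n} le = +-mono-≤ (le zero) (sumFin-mono-≤ (le ∘ suc))

sumFin-const : ∀ n k → sumFin {n} (λ _ → k) ≡ n * k
sumFin-const zero    k = refl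
sumFin-const (suc n) k = cong (k +_) (sumFin-const n k)

sumFin-+ : ∀ {n} (f g : Fin n → ℕ) → sumFin (λ i → f i + g i) ≡ sumFin f + sumFin g
sumFin-+ {zero}  f g = refl
sumFin-+ {suc n} f g = trans (cong (f zero + g zero +_) (sumFin-+ (f ∘ suc) (g ∘ suc)))
                             (interchange (f zero) (g zero) _ _)
  where
  interchange : ∀ a b c d → a + b + (c + d) ≡ a + c + (b + d)
  interchange = solve-∀

-- Replaces a subtraction of natural numbers: `c` will hold the old entries of a line, `a` the new
-- ones, `b` what was lost and `d` what was gained.
sumFin-+-cancel : ∀ {n} (a b c d : Fin n → ℕ) → (∀ i → a i + b i ≡ c i + d i) →
  sumFin b ≡ sumFin d → sumFin a ≡ sumFin c
sumFin-+-cancel a b c d eq b≡d = +-cancelʳ-≡ (sumFin b) _ _ (begin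
  sumFin a + sumFin b       ≡⟨ sumFin-+ a b ⟨
  sumFin (λ i → a i + b i)  ≡⟨ sumFin-cong eq ⟩
  sumFin (λ i → c i + d i)  ≡⟨ sumFin-+ c d ⟩
  sumFin c + sumFin d       ≡⟨ cong (sumFin c +_) b≡d ⟨
  sumFin c + sumFin b       ∎)
  where open ≡-Reasoning

sumFin-partition : ∀ {n k} (a b c : Fin n → ℕ) → (∀ i → a i + b i + c i ≡ k) →
  sumFin a + sumFin b + sumFin c ≡ n * k
sumFin-partition {n} {k} a b c eq = begin
  sumFin a + sumFin b + sumFin c       ≡⟨ cong (_+ sumFin c) (sumFin-+ a b) ⟨
  sumFin (λ i → a i + b i) + sumFin c  ≡⟨ sumFin-+ (λ i → a i + b i) c ⟨
  sumFin (λ i → a i + b i + c i)       ≡⟨ sumFin-cong eq ⟩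
  sumFin {n} (λ _ → k)                 ≡⟨ sumFin-const n k ⟩
  n * k                                ∎
  where open ≡-Reasoning

sumFin-swap : ∀ {m n} (f : Fin m → Fin n → ℕ) →
  sumFin (λ i → sumFin (f i)) ≡ sumFin (λ j → sumFin (λ i → f i j))
sumFin-swap {zero}  {n} f = sym (trans (sumFin-const n 0) (*-zeroʳ n))
sumFin-swap {suc m}     f = trans (cong (sumFin (f zero) +_) (sumFin-swap (f ∘ suc)))
                                  (sym (sumFin-+ (f zero) (λ j → sumFin (λ i → f (suc i) j))))

-- A strict inequality at one index could not be made up for elsewhere. This rigidity turns equal
-- line sums into equal entries.
sumFin-≤-≡ : ∀ {n} {f g : Fin n → ℕ} → (∀ i → f i ≤ g i) → sumFin f ≡ sumFin g →
  ∀ i → f i ≡ g i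
sumFin-≤-≡ {suc n} {f} {g} le eq = λ where
    zero    → head
    (suc i) → sumFin-≤-≡ (le ∘ suc) tail i
  where
  head : f zero ≡ g zero
  head = ≤-antisym (le zero) (+-cancelʳ-≤ (sumFin (f ∘ suc)) _ _
    (≤-trans (+-monoʳ-≤ (g zero) (sumFin-mono-≤ (le ∘ suc))) (≤-reflexive (sym eq))))
  tail : sumFin (f ∘ suc) ≡ sumFin (g ∘ suc)
  tail = +-cancelˡ-≡ (f zero) _ _ (trans eq (cong (_+ _) (sym head)))

AtMostOne : ∀ {n} → (Fin n → Bool) → Set
AtMostOne f = ∀ i j → f i ≡ true → f j ≡ true → i ≡ j

sumFin-none : ∀ {n} {f : Fin n → Bool} → (∀ i → f i ≡ false) → sumFin (bit ∘ f) ≡ 0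
sumFin-none {zero}  none = refl
sumFin-none {suc n} none = cong₂ _+_ (cong bit (none zero)) (sumFin-none (none ∘ suc))

sumFin-one : ∀ {n} {f : Fin n → Bool} → AtMostOne f → ∀ i → f i ≡ true → sumFin (bit ∘ f) ≡ 1
sumFin-one {suc n} amo zero    eq = cong₂ _+_ (cong bit eq)
  (sumFin-none λ j → Bool.¬-not λ fj → contradiction (amo zero (suc j) eq fj) λ ())
sumFin-one {suc n} amo (suc i) eq = cong₂ _+_
  (cong bit (Bool.¬-not λ f0 → contradiction (amo zero (suc i) f0 eq) λ ()))
  (sumFin-one (λ j k p q → Fin.suc-injective (amo (suc j) (suc k) p q)) i eq)

-- Either sum is 0 or 1, so only the existence of a true index matters.
sumFin-one-cong : ∀ {n} {f g : Fin n → Bool} → AtMostOne f → AtMostOne g →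
  (∃ (λ i → f i ≡ true) → ∃ (λ i → g i ≡ true)) →
  (∃ (λ i → g i ≡ true) → ∃ (λ i → f i ≡ true)) →
  sumFin (bit ∘ f) ≡ sumFin (bit ∘ g)
sumFin-one-cong {f = f} {g} amof amog to from with Fin.any? (λ i → f i Bool.≟ true)
... | yes (i , fi) = let (j , gj) = to (i , fi) in
  trans (sumFin-one amof i fi) (sym (sumFin-one amog j gj))
... | no none = trans (sumFin-none λ i → Bool.¬-not λ fi → none (i , fi))
  (sym (sumFin-none λ i → Bool.¬-not λ gi → none (from (i , gi))))

-- The orientation of the complete bipartite graph

-- `inj₁` holds the rows and `inj₂` the columns.
Vertex : ℕ → Set
Vertex n = Fin n ⊎ Fin n

_≟ᵥ_ : ∀ {n} → Decidable {A = Vertex n} _≡_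
_≟ᵥ_ = ≡-dec Fin._≟_ Fin._≟_

anyVertex? : ∀ {n} {P : Vertex n → Set} → U.Decidable P → Dec (∃ P)
anyVertex? {P = P} P? = map′ to from (Fin.any? (P? ∘ inj₁) ⊎-dec Fin.any? (P? ∘ inj₂))
  where
  to : ∃ (P ∘ inj₁) ⊎ ∃ (P ∘ inj₂) → ∃ P
  to (inj₁ (i , p)) = inj₁ i , p
  to (inj₂ (j , p)) = inj₂ j , p
  from : ∃ P → ∃ (P ∘ inj₁) ⊎ ∃ (P ∘ inj₂)
  from (inj₁ i , p) = inj₁ (i , p)
  from (inj₂ j , p) = inj₂ (j , p)

vertex-pigeonhole : ∀ {n} (f : Fin (suc (n + n)) → Vertex n) →
  ∃₂ λ i j → toℕ i < toℕ j × f i ≡ f j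
vertex-pigeonhole {n} f =
  let (i , j , i<j , eq) = Fin.pigeonhole ≤-refl (join n n ∘ f) in
  i , j , i<j , trans (sym (Fin.splitAt-join n n (f i)))
                      (trans (cong (splitAt n) eq) (Fin.splitAt-join n n (f j)))

Arc : ∀ {n} → Matrix n → Vertex n → Vertex n → Set
Arc M (inj₁ i) (inj₂ j) = M i j ≡ true
Arc M (inj₂ j) (inj₁ i) = M i j ≡ false
Arc M _        _        = ⊥

-- A cell is looked up whatever the direction of its arc. The default `false` covers pairs on one
-- side, which carry no arc.
at : ∀ {n} → Mask n → Vertex n → Vertex n → Bool
at S (inj₁ i) (inj₂ j) = S i j
at S (inj₂ j) (inj₁ i) = S i j
at S _        _        = false

FreeArc : ∀ {n} → Matrix n → Mask n → Vertex n → Vertex n → Set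
FreeArc M S u v = Arc M u v × at S u v ≡ false

arc? : ∀ {n} (M : Matrix n) → Decidable (Arc M)
arc? M (inj₁ i) (inj₁ j) = no λ ()
arc? M (inj₁ i) (inj₂ j) = M i j Bool.≟ true
arc? M (inj₂ j) (inj₁ i) = M i j Bool.≟ false
arc? M (inj₂ i) (inj₂ j) = no λ ()

freeArc? : ∀ {n} (M : Matrix n) (S : Mask n) → Decidable (FreeArc M S)
freeArc? M S u v = arc? M u v ×-dec (at S u v Bool.≟ false)

arc-asym : ∀ {n} (M : Matrix n) u v → Arc M u v → ¬ Arc M v u
arc-asym M (inj₁ i) (inj₂ j) uv vu = true≢false uv vu
arc-asym M (inj₂ j) (inj₁ i) uv vu = true≢false vu uv

-- Potentials on the vertices as certificates of unique determination

Ascending : ∀ {n} → (Vertex n → Vertex n → Set) → (Vertex n → ℕ) → Set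
Ascending R φ = ∀ u v → R u v → φ u < φ v

Determines : ∀ {n} → ℕ → Matrix n → Mask n → Set
Determines {n} x M S = ∀ (N : Matrix n) → InΛ n x N → Contains N M S → ∀ i j → N i j ≡ M i j

-- If N agrees with M at all vertices below v, then the only arcs at v on which
-- they can still differ are out-arcs; these all carry the same entry of M, so
-- equality of the line sums leaves no room for a difference.
ascending⇒determines : ∀ {n x} {M : Matrix n} {S : Mask n} → InΛ n x M →
  ∀ φ → Ascending (FreeArc M S) φ → Determines x M S
ascending⇒determines {n} {x} {M} {S} (rowsM , colsM) φ asc N (rowsN , colsN) con =
  λ i j → agree _ (inj₁ i) ≤-refl j
  where
  Agree : Vertex n → Set
  Agree (inj₁ i) = ∀ j → N i j ≡ M i j
  Agree (inj₂ j) = ∀ i → N i j ≡ M i j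

  step : ∀ v → (∀ u → φ u < φ v → Agree u) → Agree v
  step (inj₁ i) ih j = bit-injective _ _
    (sumFin-≤-≡ le (trans (rowsN i) (sym (rowsM i))) j)
    where
    le : ∀ j → bit (N i j) ≤ bit (M i j)
    le j with M i j in eqM | S i j in eqS
    ... | true  | _     = bit≤1 _
    ... | false | true  = ≤-reflexive (cong bit (trans (con i j eqS) eqM))
    ... | false | false = ≤-reflexive (cong bit (trans
      (ih (inj₂ j) (asc (inj₂ j) (inj₁ i) (eqM , eqS)) i) eqM))
  -- At a column the out-arcs are the zeros of `M`, so the inequality is reversed.
  step (inj₂ j) ih i = sym (bit-injective _ _
    (sumFin-≤-≡ ge (trans (colsM j) (sym (colsN j))) i))
    where
    ge : ∀ i → bit (M i j) ≤ bit (N i j)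
    ge i with M i j in eqM | S i j in eqS
    ... | false | _     = z≤n
    ... | true  | true  = ≤-reflexive (cong bit (sym (trans (con i j eqS) eqM)))
    ... | true  | false = ≤-reflexive (cong bit (sym (trans
      (ih (inj₁ i) (asc (inj₁ i) (inj₂ j) (eqM , eqS)) j) eqM)))

  -- Strong induction on `φ`, with `k` as an explicit bound.
  agree : ∀ k v → φ v < k → Agree v
  agree (suc k) v v<k = step v λ u u<v → agree k u (<-≤-trans u<v (s≤s⁻¹ v<k))

-- Longest walks

-- A nonempty union of vertex-disjoint directed cycles: `pred` permutes `On` with inverse `succ`.
-- Off `On` both maps are unconstrained.
record Cycles {n} (R : Vertex n → Vertex n → Set) : Set₁ where
  field
    On        : Vertex n → Set
    on?       : U.Decidable On
    pred      : Vertex n → Vertex n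
    succ      : Vertex n → Vertex n
    pred-arc  : ∀ v → On v → R (pred v) v
    on-pred   : ∀ v → On v → On (pred v)
    on-succ   : ∀ v → On v → On (succ v)
    pred-succ : ∀ v → On v → pred (succ v) ≡ v
    succ-pred : ∀ v → On v → succ (pred v) ≡ v
    nonempty  : ∃ On

-- `ascending` makes levels at least the length of any walk, and `tight` makes them attained.
-- `bound` will allow the order to be reversed.
record Levels {n} (R : Vertex n → Vertex n → Set) : Set where
  field
    level     : Vertex n → ℕ
    bound     : ℕ
    level≤    : ∀ v → level v ≤ bound
    ascending : Ascending R level
    tight     : ∀ v → level v ≢ 0 → ∃ λ u → R u v × level v ≡ suc (level u)

module _ {n} (R : Vertex n → Vertex n → Set) (R? : Decidable R) where

  Walk : ℕ → Vertex n → Set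
  Walk zero    v = ⊤
  Walk (suc k) v = ∃ λ u → R u v × Walk k u

  walk? : ∀ k → U.Decidable (Walk k)
  walk? zero    v = yes tt
  walk? (suc k) v = anyVertex? λ u → R? u v ×-dec walk? k u

  walk-pred : ∀ k v → Walk (suc k) v → Walk k v
  walk-pred zero    v _           = tt
  walk-pred (suc k) v (u , r , w) = u , r , walk-pred k u w

  walk-drop : ∀ d k v → Walk (d + k) v → Walk k v
  walk-drop zero    k v w = w
  walk-drop (suc d) k v w = walk-drop d k v (walk-pred (d + k) v w)

  walk-antitone : ∀ {j k} v → j ≤ k → Walk k v → Walk j v
  walk-antitone {j} {k} v j≤k w = walk-drop (k ∸ j) j v (subst (λ l → Walk l v) (sym (m∸n+n≡m j≤k)) w)

  -- A walk can be shortened at its start, so at most one `k` qualifies for each `v`: the length of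
  -- a longest walk into `v`.
  Last : ℕ → Vertex n → Set
  Last k v = Walk k v × ¬ Walk (suc k) v

  last? : ∀ k → U.Decidable (Last k)
  last? k v = walk? k v ×-dec ¬? (walk? (suc k) v)

  Stable : ℕ → Set
  Stable k = ∀ v → Walk k v → Walk (suc k) v

  -- Otherwise each of the `2n + 1` lengths from 0 to `2n` is the longest walk length of some
  -- vertex. Two lengths then share a vertex, although that length is unique.
  stable : ∃ Stable
  stable with Fin.all? {n = suc (n + n)} (λ k → anyVertex? (last? (toℕ k)))
  ... | no ¬all =
    let (k , none) = Fin.¬∀⟶∃¬ _ _ (λ k → anyVertex? (last? (toℕ k))) ¬all in
    toℕ k , λ v w → decidable-stable (walk? _ v) λ ¬w → none (v , w , ¬w)
  ... | yes all =
    let (i , j , i<j , eq) = vertex-pigeonhole (proj₁ ∘ all)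
        (_ , _ , ¬w) = all i
        (v , w , _) = all j in
    ⊥-elim (¬w (subst (Walk (suc (toℕ i))) (sym eq) (walk-antitone v i<j w)))

  module _ (k : ℕ) (st : Stable k) where

    private
      -- By stability, a vertex ending a walk of length `k` has an in-neighbour that ends one too,
      -- so `p` can be iterated forever. The value `v` in the other case is a filler.
      p : Vertex n → Vertex n
      p v with walk? k v
      ... | yes w = proj₁ (st v w)
      ... | no  _ = v

      p-arc : ∀ v → Walk k v → R (p v) v × Walk k (p v)
      p-arc v w with walk? k v
      ... | yes w′ = proj₂ (st v w′)
      ... | no ¬w  = ⊥-elim (¬w w)

      iter : ℕ → Vertex n → Vertex n
      iter zero    v = v
      iter (suc i) v = p (iter i v)

      iter-+ : ∀ a b v → iter (a + b) v ≡ iter a (iter b v)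
      iter-+ zero    b v = refl
      iter-+ (suc a) b v = cong p (iter-+ a b v)

      iter-comm : ∀ a b v → iter a (iter b v) ≡ iter b (iter a v)
      iter-comm a b v = trans (sym (iter-+ a b v))
        (trans (cong (λ c → iter c v) (+-comm a b)) (iter-+ b a v))

      iter-walk : ∀ i v → Walk k v → Walk k (iter i v)
      iter-walk zero    v w = w
      iter-walk (suc i) v w = proj₂ (p-arc _ (iter-walk i v w))

      periodic : ∀ v → Walk k v → ∃₂ λ e u → Walk k u × iter (suc e) u ≡ u
      periodic v w with vertex-pigeonhole {n} (λ i → iter (toℕ i) v)
      ... | i , j , i<j , eq with m≤n⇒∃[o]m+o≡n i<j
      -- Here `suc i + e` equals `j`, so the period `suc e` is positive and `iter e` will serve as
      -- the inverse of `p`.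
      ... | e , i+e = e , iter (toℕ i) v , iter-walk (toℕ i) v w ,
        trans (sym (iter-+ (suc e) (toℕ i) v))
          (trans (cong (λ l → iter l v) (trans (cong suc (+-comm e (toℕ i))) i+e)) (sym eq))

    -- The vertices fixed by a power of the predecessor map form disjoint cycles.
    stable⇒cycles : ∃ (Walk k) → Cycles R
    stable⇒cycles (v , w) with periodic v w
    ... | e , u , wu , fix = record
      { On   = λ x → Walk k x × iter (suc e) x ≡ x
      ; on?  = λ x → walk? k x ×-dec (iter (suc e) x ≟ᵥ x)
      ; pred = p
      ; succ = iter e
      ; pred-arc = λ x on → proj₁ (p-arc x (proj₁ on))
      ; on-pred = λ x on → iter-walk 1 x (proj₁ on) , trans (iter-comm (suc e) 1 x) (cong p (proj₂ on))
      ; on-succ = λ x on → iter-walk e x (proj₁ on) , trans (iter-comm (suc e) e x) (cong (iter e) (proj₂ on))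
      ; pred-succ = λ x on → proj₂ on
      ; succ-pred = λ x on → trans (iter-comm e 1 x) (proj₂ on)
      ; nonempty = u , wu , fix
      }

  module _ (k : ℕ) (none : ∀ v → ¬ Walk k v) where

    private
      last : ∀ k v → ¬ Walk k v → ∃ λ l → Last l v × l ≤ k
      last zero    v ¬w = ⊥-elim (¬w tt)
      last (suc k) v ¬w with walk? k v
      ... | yes w = k , (w , ¬w) , n≤1+n k
      ... | no ¬w′ = let (l , la , l≤k) = last k v ¬w′ in l , la , m≤n⇒m≤1+n l≤k

      lev : Vertex n → ℕ
      lev v = proj₁ (last k v (none v))

      isLast : ∀ v → Last (lev v) v
      isLast v = proj₁ (proj₂ (last k v (none v)))

      walk≤lev : ∀ {j} v → Walk j v → j ≤ lev v
      walk≤lev v w = ≮⇒≥ λ l<j → proj₂ (isLast v) (walk-antitone v l<j w)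

      asc : Ascending R lev
      asc u v r = walk≤lev v (u , r , proj₁ (isLast u))

      -- Take the last arc of a longest walk into `v`: its tail ends a walk one arc shorter, and
      -- ascent excludes a higher level.
      tight′ : ∀ l v → lev v ≡ suc l → ∃ λ u → R u v × lev v ≡ suc (lev u)
      tight′ l v eq with subst (λ j → Walk j v) eq (proj₁ (isLast v))
      ... | u , r , w = u , r , ≤-antisym (subst (_≤ suc (lev u)) (sym eq) (s≤s (walk≤lev u w))) (asc u v r)

    walkless⇒levels : Levels R
    walkless⇒levels = record
      { level = lev
      ; bound = k
      ; level≤ = λ v → proj₂ (proj₂ (last k v (none v)))
      ; ascending = asc
      ; tight = λ v → tight-at v (lev v) refl
      }
      where
      tight-at : ∀ v l → lev v ≡ l → lev v ≢ 0 → ∃ λ u → R u v × lev v ≡ suc (lev u)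
      tight-at v zero    eq ≢0 = ⊥-elim (≢0 eq)
      tight-at v (suc l) eq _  = tight′ l v eq

  -- At a stable length, a surviving walk can be followed backwards until it repeats. If none
  -- survives, walk lengths are bounded and longest walks exist.
  levels-or-cycles : Levels R ⊎ Cycles R
  levels-or-cycles with stable
  ... | k , st with anyVertex? (walk? k)
  ... | yes w = inj₂ (stable⇒cycles k st w)
  ... | no ¬w = inj₁ (walkless⇒levels k λ v w → ¬w (v , w))

-- Trades

module _ {n x} {M : Matrix n} {S : Mask n} (inΛ : InΛ n x M) (cyc : Cycles (FreeArc M S)) where
  open Cycles cyc

  private
    flip? : ∀ u v → Dec (On v × pred v ≡ u)
    flip? u v = on? v ×-dec (pred v ≟ᵥ u)

    flip : Vertex n → Vertex n → Bool
    flip u v = does (flip? u v)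

    flip-free : ∀ u v → flip u v ≡ true → FreeArc M S u v
    flip-free u v f with does-sound (flip? u v) f
    ... | on , refl = pred-arc v on

    flip-arc : ∀ v → On v → flip (pred v) v ≡ true
    flip-arc v on = dec-true (flip? (pred v) v) (on , refl)

    -- A vertex on the cycles has exactly one incoming and one outgoing cycle arc, any other vertex
    -- has neither. `ι` enumerates the side opposite to `v`.
    flip-balanced : ∀ v (ι : Fin n → Vertex n) → Injective _≡_ _≡_ ι →
      (∀ u → Arc M u v ⊎ Arc M v u → ∃ λ i → u ≡ ι i) →
      sumFin (λ i → bit (flip (ι i) v)) ≡ sumFin (λ i → bit (flip v (ι i)))
    flip-balanced v ι inj nbr = sumFin-one-cong
      (λ i j p q → inj (trans (sym (proj₂ (does-sound (flip? (ι i) v) p)))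
                              (proj₂ (does-sound (flip? (ι j) v) q))))
      (λ i j p q →
        let (oni , pi) = does-sound (flip? v (ι i)) p
            (onj , pj) = does-sound (flip? v (ι j)) q in
        inj (trans (sym (succ-pred _ oni)) (trans (cong succ (trans pi (sym pj))) (succ-pred _ onj))))
      (λ (i , p) → out (proj₁ (does-sound (flip? (ι i) v) p)))
      (λ (i , p) →
        let (on , eq) = does-sound (flip? v (ι i)) p in
        into (subst On eq (on-pred _ on)))
      where
      out : On v → ∃ λ i → flip v (ι i) ≡ true
      out on with nbr (succ v) (inj₂ (subst (λ w → Arc M w (succ v)) (pred-succ v on)
                                            (proj₁ (pred-arc (succ v) (on-succ v on)))))
      ... | i , eq = i , dec-true (flip? v (ι i))
        (subst On eq (on-succ v on) , trans (cong pred (sym eq)) (pred-succ v on))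
      into : On v → ∃ λ i → flip (ι i) v ≡ true
      into on with nbr (pred v) (inj₁ (proj₁ (pred-arc v on)))
      ... | i , eq = i , dec-true (flip? (ι i) v) (on , eq)

    -- Reverses all cycle arcs at once. Each cell consults only the flip in the direction of its own
    -- arc.
    trade : Matrix n
    trade i j = if M i j then not (flip (inj₁ i) (inj₂ j)) else flip (inj₂ j) (inj₁ i)

    trade-bit : ∀ i j → bit (trade i j) + bit (flip (inj₁ i) (inj₂ j))
                      ≡ bit (M i j) + bit (flip (inj₂ j) (inj₁ i))
    trade-bit i j with M i j in eq | flip (inj₁ i) (inj₂ j) in f | flip (inj₂ j) (inj₁ i) in g
    ... | true  | _     | true  = ⊥-elim (true≢false eq (proj₁ (flip-free _ _ g)))
    ... | true  | true  | false = refl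
    ... | true  | false | false = refl
    ... | false | true  | _     = ⊥-elim (true≢false (proj₁ (flip-free _ _ f)) eq)
    ... | false | false | true  = refl
    ... | false | false | false = refl

    trade-rows : ∀ i → rowSum trade i ≡ rowSum M i
    trade-rows i = sumFin-+-cancel
      (λ j → bit (trade i j)) (λ j → bit (flip (inj₁ i) (inj₂ j)))
      (λ j → bit (M i j)) (λ j → bit (flip (inj₂ j) (inj₁ i)))
      (trade-bit i) (sym (flip-balanced (inj₁ i) inj₂ inj₂-injective nbr))
      where
      nbr : ∀ u → Arc M u (inj₁ i) ⊎ Arc M (inj₁ i) u → ∃ λ j → u ≡ inj₂ j
      nbr (inj₁ _) (inj₁ ())
      nbr (inj₁ _) (inj₂ ())
      nbr (inj₂ j) _ = j , refl

    trade-cols : ∀ j → colSum trade j ≡ colSum M j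
    trade-cols j = sumFin-+-cancel
      (λ i → bit (trade i j)) (λ i → bit (flip (inj₁ i) (inj₂ j)))
      (λ i → bit (M i j)) (λ i → bit (flip (inj₂ j) (inj₁ i)))
      (λ i → trade-bit i j) (flip-balanced (inj₂ j) inj₁ inj₁-injective nbr)
      where
      nbr : ∀ u → Arc M u (inj₂ j) ⊎ Arc M (inj₂ j) u → ∃ λ i → u ≡ inj₁ i
      nbr (inj₂ _) (inj₁ ())
      nbr (inj₂ _) (inj₂ ())
      nbr (inj₁ i) _ = i , refl

    trade-contains : Contains trade M S
    trade-contains i j s with M i j in eq | flip (inj₁ i) (inj₂ j) in f | flip (inj₂ j) (inj₁ i) in g
    ... | true  | true  | _     = ⊥-elim (true≢false s (proj₂ (flip-free _ _ f)))
    ... | true  | false | _     = refl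
    ... | false | _     | true  = ⊥-elim (true≢false s (proj₂ (flip-free _ _ g)))
    ... | false | _     | false = refl

    trade-differs : ∀ u v → flip u v ≡ true → ¬ (∀ i j → trade i j ≡ M i j)
    trade-differs (inj₁ i) (inj₂ j) f same =
      let m = proj₁ (flip-free (inj₁ i) (inj₂ j) f) in
      true≢false (trans (same i j) m)
        (trans (cong (if_then not (flip (inj₁ i) (inj₂ j)) else flip (inj₂ j) (inj₁ i)) m) (cong not f))
    trade-differs (inj₂ j) (inj₁ i) f same =
      let m = proj₁ (flip-free (inj₂ j) (inj₁ i) f) in
      true≢false
        (trans (cong (if_then not (flip (inj₁ i) (inj₂ j)) else flip (inj₂ j) (inj₁ i)) m) f)
        (trans (same i j) m)
    trade-differs (inj₁ i) (inj₁ j) f same = proj₁ (flip-free (inj₁ i) (inj₁ j) f)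
    trade-differs (inj₂ i) (inj₂ j) f same = proj₁ (flip-free (inj₂ i) (inj₂ j) f)

  -- Reversing the cycles keeps every margin and every entry in `S`, yet changes `M`.
  cycles⇒¬determines : ¬ Determines x M S
  cycles⇒¬determines det = let (v , on) = nonempty in
    trade-differs (pred v) v (flip-arc v on)
      (det trade ((λ i → trans (trade-rows i) (proj₁ inΛ i)) , (λ j → trans (trade-cols j) (proj₂ inΛ j)))
        trade-contains)

determines⇒levels : ∀ {n x} {M : Matrix n} {S : Mask n} → InΛ n x M → Determines x M S →
  Levels (FreeArc M S)
determines⇒levels {M = M} {S} inΛ det with levels-or-cycles (FreeArc M S) (freeArc? M S)
... | inj₁ levels = levels
... | inj₂ cycles = ⊥-elim (cycles⇒¬determines inΛ cycles det)

-- Critical sets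

Critical : ∀ {n} → ℕ → Matrix n → Mask n → Set
Critical x M C = Determines x M C × (∀ S → S ⊂ₘ C → ¬ Determines x M S)

delete : ∀ {n} → Fin n → Fin n → Mask n → Mask n
delete i j C k l = C k l ∧ not (does ((i Fin.≟ k) ×-dec (j Fin.≟ l)))

delete-⊂ : ∀ {n} i j (C : Mask n) → C i j ≡ true → delete i j C ⊂ₘ C
delete-⊂ i j C c = sub , λ same → true≢false (trans (same i j) c)
    (trans (cong (λ b → C i j ∧ not b) (dec-true ((i Fin.≟ i) ×-dec (j Fin.≟ j)) (refl , refl)))
           (Bool.∧-zeroʳ (C i j)))
  where
  sub : delete i j C ⊆ₘ C
  sub k l eq with C k l
  ... | true  = refl
  sub k l () | false

delete-false : ∀ {n} i j (C : Mask n) k l → delete i j C k l ≡ false →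
  C k l ≡ false ⊎ (i ≡ k × j ≡ l)
delete-false i j C k l eq with C k l | i Fin.≟ k | j Fin.≟ l
... | false | _      | _      = inj₁ refl
... | true  | yes ik | yes jl = inj₂ (ik , jl)
delete-false i j C k l () | true | yes _ | no _
delete-false i j C k l () | true | no _  | _

-- If `φ` also rose along this arc of `C`, it would certify that `C` without the arc still
-- determines `M`, against minimality.
critical⇒no-ascent : ∀ {n x} {M : Matrix n} {C : Mask n} → InΛ n x M → Critical x M C →
  ∀ u v → Arc M u v → at C u v ≡ true →
  ∀ φ → Ascending (FreeArc M C) φ → ¬ φ u < φ v
critical⇒no-ascent {M = M} {C} inΛ (_ , minimal) (inj₁ i) (inj₂ j) m c φ asc φ< =
  minimal (delete i j C) (delete-⊂ i j C c) (ascending⇒determines inΛ φ asc′)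
  where
  asc′ : Ascending (FreeArc M (delete i j C)) φ
  asc′ (inj₁ k) (inj₂ l) (a , d) with delete-false i j C k l d
  ... | inj₁ free          = asc (inj₁ k) (inj₂ l) (a , free)
  ... | inj₂ (refl , refl) = φ<
  asc′ (inj₂ l) (inj₁ k) (a , d) with delete-false i j C k l d
  ... | inj₁ free          = asc (inj₂ l) (inj₁ k) (a , free)
  ... | inj₂ (refl , refl) = ⊥-elim (true≢false m a)
critical⇒no-ascent {M = M} {C} inΛ (_ , minimal) (inj₂ j) (inj₁ i) m c φ asc φ< =
  minimal (delete i j C) (delete-⊂ i j C c) (ascending⇒determines inΛ φ asc′)
  where
  asc′ : Ascending (FreeArc M (delete i j C)) φ
  asc′ (inj₁ k) (inj₂ l) (a , d) with delete-false i j C k l d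
  ... | inj₁ free          = asc (inj₁ k) (inj₂ l) (a , free)
  ... | inj₂ (refl , refl) = ⊥-elim (true≢false a m)
  asc′ (inj₂ l) (inj₁ k) (a , d) with delete-false i j C k l d
  ... | inj₁ free          = asc (inj₂ l) (inj₁ k) (a , free)
  ... | inj₂ (refl , refl) = φ<

-- Otherwise shifting u down and v up within 3 · level makes the arc u → v ascend.
critical⇒drop : ∀ {n x} {M : Matrix n} {C : Mask n} → InΛ n x M → Critical x M C →
  ∀ level → Ascending (FreeArc M C) level →
  ∀ u v → Arc M u v → at C u v ≡ true → 2 + level v ≤ level u
critical⇒drop {n} {M = M} {C} inΛ crit level asc u v uv c =
  ≮⇒≥ λ lu<2+lv → critical⇒no-ascent inΛ crit u v uv c φ φ-asc (φu<φv (s≤s⁻¹ lu<2+lv))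
  where
  -- A free arc gains at least 3 from `3 * level` and loses at most 2 from the offsets. Only the
  -- pair from `v` to `u` could lose 4, and it is no arc. The arc from `u` to `v` loses at most 3 by
  -- level and gains 4.
  offset : Vertex n → ℕ
  offset w = if does (w ≟ᵥ u) then 0 else if does (w ≟ᵥ v) then 4 else 2

  φ : Vertex n → ℕ
  φ w = 3 * level w + offset w

  v≢u : v ≢ u
  v≢u refl = arc-asym M u u uv uv

  offset-u : offset u ≡ 0
  offset-u with u ≟ᵥ u
  ... | yes _ = refl
  ... | no ≢  = ⊥-elim (≢ refl)

  offset-v : offset v ≡ 4
  offset-v with v ≟ᵥ u | v ≟ᵥ v
  ... | yes eq | _     = ⊥-elim (v≢u eq)
  ... | no _   | yes _ = refl
  ... | no _   | no ≢  = ⊥-elim (≢ refl)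

  offset-≤ : ∀ a b → ¬ (a ≡ v × b ≡ u) → offset a ≤ 2 + offset b
  offset-≤ a b ≢vu with a ≟ᵥ u
  ... | yes _ = z≤n
  ... | no _ with a ≟ᵥ v
  ... | no _ = s≤s (s≤s z≤n)
  ... | yes eq with b ≟ᵥ u
  ... | yes eq′ = ⊥-elim (≢vu (eq , eq′))
  ... | no _ with b ≟ᵥ v
  ... | yes _ = s≤s (s≤s (s≤s (s≤s z≤n)))
  ... | no _  = ≤-refl

  φ-asc : Ascending (FreeArc M C) φ
  φ-asc a b (ab , f) = begin-strict
    3 * level a + offset a       ≤⟨ +-monoʳ-≤ (3 * level a) (offset-≤ a b λ where
                                      (refl , refl) → arc-asym M u v uv ab) ⟩
    3 * level a + (2 + offset b) <⟨ ≤-reflexive (regroup (level a) (offset b)) ⟩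
    3 * suc (level a) + offset b ≤⟨ +-monoˡ-≤ (offset b) (*-monoʳ-≤ 3 (asc a b (ab , f))) ⟩
    3 * level b + offset b       ∎
    where
    open ≤-Reasoning
    regroup : ∀ l o → suc (3 * l + (2 + o)) ≡ 3 * suc l + o
    regroup = solve-∀

  φu<φv : level u ≤ suc (level v) → φ u < φ v
  φu<φv lu≤ = begin-strict
    3 * level u + offset u ≡⟨ cong (3 * level u +_) offset-u ⟩
    3 * level u + 0        ≤⟨ +-monoˡ-≤ 0 (*-monoʳ-≤ 3 lu≤) ⟩
    3 * suc (level v) + 0  <⟨ ≤-reflexive (regroup (level v)) ⟩
    3 * level v + 4        ≡⟨ cong (3 * level v +_) offset-v ⟨
    3 * level v + offset v ∎
    where
    open ≤-Reasoning
    regroup : ∀ l → suc (3 * suc l + 0) ≡ 3 * l + 4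
    regroup = solve-∀

-- The complement of a critical set enlarged by `n` further arcs

module _ {n x} {M : Matrix n} {C : Mask n} (inΛ : InΛ n x M) (crit : Critical x M C)
         (levels : Levels (FreeArc M C)) where
  open Levels levels

  private
    Result : Set
    Result = Σ (Mask n) λ D → Determines x M D × Disjoint D C × size D + size C + n ≡ n * n

    drop : ∀ u v → Arc M u v → at C u v ≡ true → 2 + level v ≤ level u
    drop = critical⇒drop inΛ crit level ascending

  -- Treats both choices of side together: `β` is 3 at tails of `T` and 0 at heads. Along an arc of
  -- `C`, `2 * level` falls by at least 4 and `β` rises by at most 3; along an arc of `T`,
  -- `2 * level` rises by 2 and `β` falls by 3.
  complement : (T : Mask n) (β : Vertex n → ℕ) → (∀ v → β v ≤ 3) →
    (∀ u v → Arc M u v → at T u v ≡ true →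
      at C u v ≡ false × level v ≡ suc (level u) × β u ≡ 3 × β v ≡ 0) →
    size T ≡ n → Result
  complement T β β≤3 T-arc |T|≡n = D , ascending⇒determines inΛ φ φ-asc , disjoint , count
    where
    D : Mask n
    D i j = not (C i j ∨ T i j)

    disjoint : Disjoint D C
    disjoint i j d with C i j
    ... | false = refl
    disjoint i j () | true

    T-free : ∀ i j → T i j ≡ true → C i j ≡ false
    T-free i j t with M i j in eq
    ... | true  = proj₁ (T-arc (inj₁ i) (inj₂ j) eq t)
    ... | false = proj₁ (T-arc (inj₂ j) (inj₁ i) eq t)

    cell-count : ∀ i j → bit (D i j) + bit (C i j) + bit (T i j) ≡ 1
    cell-count i j with C i j in c | T i j in t
    ... | true  | true  = ⊥-elim (true≢false c (T-free i j t))
    ... | true  | false = refl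
    ... | false | true  = refl
    ... | false | false = refl

    count : size D + size C + n ≡ n * n
    count = trans (cong (size D + size C +_) (sym |T|≡n))
      (sumFin-partition (sumFin ∘ row D) (sumFin ∘ row C) (sumFin ∘ row T)
        λ i → trans (sumFin-partition (row D i) (row C i) (row T i) (cell-count i)) (*-identityʳ n))
      where
      row : Mask n → Fin n → Fin n → ℕ
      row S i j = bit (S i j)

    ψ : Vertex n → ℕ
    ψ v = 2 * level v + β v

    -- An upper bound for `ψ`, so that the truncated subtraction in `φ` is exact and reverses the
    -- order.
    Ψ : ℕ
    Ψ = 2 * bound + 3

    φ : Vertex n → ℕ
    φ v = Ψ ∸ ψ v

    ψ≤Ψ : ∀ v → ψ v ≤ Ψ
    ψ≤Ψ v = +-mono-≤ (*-monoʳ-≤ 2 (level≤ v)) (β≤3 v)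

    C-descends : ∀ u v → Arc M u v → at C u v ≡ true → ψ v < ψ u
    C-descends u v uv c = begin-strict
      2 * level v + β v   ≤⟨ +-monoʳ-≤ (2 * level v) (β≤3 v) ⟩
      2 * level v + 3     <⟨ ≤-reflexive (regroup (level v)) ⟩
      2 * (2 + level v)   ≤⟨ *-monoʳ-≤ 2 (drop u v uv c) ⟩
      2 * level u         ≤⟨ m≤m+n _ _ ⟩
      2 * level u + β u   ∎
      where
      open ≤-Reasoning
      regroup : ∀ l → suc (2 * l + 3) ≡ 2 * (2 + l)
      regroup = solve-∀

    T-descends : ∀ u v → Arc M u v → at T u v ≡ true → ψ v < ψ u
    T-descends u v uv t with T-arc u v uv t
    ... | _ , lv , βu , βv rewrite lv | βu | βv = ≤-reflexive (regroup (level u))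
      where
      regroup : ∀ l → suc (2 * suc l + 0) ≡ 2 * l + 3
      regroup = solve-∀

    D-false : ∀ u v → Arc M u v → at D u v ≡ false → at C u v ≡ true ⊎ at T u v ≡ true
    D-false (inj₁ i) (inj₂ j) _ d with C i j | T i j
    ... | true  | _    = inj₁ refl
    ... | false | true = inj₂ refl
    D-false (inj₁ i) (inj₂ j) _ () | false | false
    D-false (inj₂ j) (inj₁ i) _ d with C i j | T i j
    ... | true  | _    = inj₁ refl
    ... | false | true = inj₂ refl
    D-false (inj₂ j) (inj₁ i) _ () | false | false

    φ-asc : Ascending (FreeArc M D) φ
    φ-asc u v (uv , d) = ∸-monoʳ-< ψv<ψu (ψ≤Ψ u)
      where
      ψv<ψu : ψ v < ψ u
      ψv<ψu with D-false u v uv d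
      ... | inj₁ c = C-descends u v uv c
      ... | inj₂ t = T-descends u v uv t

  size-graph : ∀ {m} (f : Fin m → Fin n) →
    sumFin (λ i → sumFin (λ j → bit (does (f i Fin.≟ j)))) ≡ m
  size-graph {m} f = trans (sumFin-cong one) (trans (sumFin-const m 1) (*-identityʳ m))
    where
    one : ∀ i → sumFin (λ j → bit (does (f i Fin.≟ j))) ≡ 1
    one i = sumFin-one (λ j k p q → trans (sym (does-sound (f i Fin.≟ j) p)) (does-sound (f i Fin.≟ k) q))
      (f i) (dec-true (f i Fin.≟ f i) refl)

  -- Tightness gives each row a free in-arc from a column one level below. One such arc per row
  -- forms `T`.
  rows-above : (∀ i → level (inj₁ i) ≢ 0) → Result
  rows-above pos = complement T β β≤3 T-arc (size-graph f)
    where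
    below : ∀ i → ∃ λ j → FreeArc M C (inj₂ j) (inj₁ i) × level (inj₁ i) ≡ suc (level (inj₂ j))
    below i with tight (inj₁ i) (pos i)
    ... | inj₂ j , p = j , p
    ... | inj₁ _ , (() , _) , _
    f : Fin n → Fin n
    f i = proj₁ (below i)
    T : Mask n
    T i j = does (f i Fin.≟ j)
    β : Vertex n → ℕ
    β (inj₁ _) = 0
    β (inj₂ _) = 3
    β≤3 : ∀ v → β v ≤ 3
    β≤3 (inj₁ _) = z≤n
    β≤3 (inj₂ _) = ≤-refl
    T-arc : ∀ u v → Arc M u v → at T u v ≡ true →
      at C u v ≡ false × level v ≡ suc (level u) × β u ≡ 3 × β v ≡ 0
    T-arc (inj₂ j) (inj₁ i) _ t with does-sound (f i Fin.≟ j) t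
    ... | refl = proj₂ (proj₁ (proj₂ (below i))) , proj₂ (proj₂ (below i)) , refl , refl
    T-arc (inj₁ i) (inj₂ j) m t with does-sound (f i Fin.≟ j) t
    ... | refl = ⊥-elim (true≢false m (proj₁ (proj₁ (proj₂ (below i)))))

  cols-above : (∀ j → level (inj₂ j) ≢ 0) → Result
  cols-above pos = complement T β β≤3 T-arc 
      -- `T` is now a transposed graph with one cell per column, so the order of summation is
      -- exchanged first.
      (trans (sumFin-swap (λ i j → bit (does (f j Fin.≟ i)))) (size-graph f))
    where
    below : ∀ j → ∃ λ i → FreeArc M C (inj₁ i) (inj₂ j) × level (inj₂ j) ≡ suc (level (inj₁ i))
    below j with tight (inj₂ j) (pos j)
    ... | inj₁ i , p = i , p
    ... | inj₂ _ , (() , _) , _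
    f : Fin n → Fin n
    f j = proj₁ (below j)
    T : Mask n
    T i j = does (f j Fin.≟ i)
    β : Vertex n → ℕ
    β (inj₁ _) = 3
    β (inj₂ _) = 0
    β≤3 : ∀ v → β v ≤ 3
    β≤3 (inj₁ _) = ≤-refl
    β≤3 (inj₂ _) = z≤n
    T-arc : ∀ u v → Arc M u v → at T u v ≡ true →
      at C u v ≡ false × level v ≡ suc (level u) × β u ≡ 3 × β v ≡ 0
    T-arc (inj₁ i) (inj₂ j) _ t with does-sound (f j Fin.≟ i) t
    ... | refl = proj₂ (proj₁ (proj₂ (below j))) , proj₂ (proj₂ (below j)) , refl , refl
    T-arc (inj₂ j) (inj₁ i) m t with does-sound (f j Fin.≟ i) t
    ... | refl = ⊥-elim (true≢false (proj₁ (proj₁ (proj₂ (below j)))) m)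

  -- An arc of `C` has its tail at level 2 or more, and a free arc has its head at level 1 or more.
  arc-level : ∀ u v → Arc M u v → level u ≡ 0 → level v ≢ 0
  arc-level u v uv lu lv with at C u v in c
  ... | true  = contradiction (subst (2 + level v ≤_) lu (drop u v uv c)) λ ()
  ... | false = contradiction (subst (level u <_) lv (ascending u v (uv , c))) λ ()

  exact-complement : Result
  exact-complement with Fin.any? (λ i → level (inj₁ i) ≟ 0)
  ... | no none = rows-above λ i eq → none (i , eq)
  -- Every column is joined to row `i`, in one direction or the other, so none shares its level 0.
  ... | yes (i , li) = cols-above above
    where
    above : ∀ j → level (inj₂ j) ≢ 0
    above j lj with M i j in eq
    ... | true  = arc-level (inj₁ i) (inj₂ j) eq li lj
    ... | false = arc-level (inj₂ j) (inj₁ i) eq lj li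

theorem11 : (m : ℕ) → m ≥ 1 → (M : Matrix (2 * m)) → InΛ (2 * m) m M →
    (C : Mask (2 * m)) → CriticalSet m M C →
    Σ (Mask (2 * m)) (λ D → DefiningSet m M D × Disjoint D C ×
    (size D + size C + 2 * m ≤ 4 * m * m))
theorem11 m _ M inΛ C ((_ , det) , minimal) =
  let (D , detD , disj , count) = exact-complement inΛ
        (det , λ S S⊂C detS → minimal S S⊂C (inΛ , detS)) (determines⇒levels inΛ det) in
  -- The construction attains the bound with equality.
  D , (inΛ , detD) , disj , ≤-reflexive (trans count (square m))
  where
  square : ∀ m → 2 * m * (2 * m) ≡ 4 * m * m
  square = solve-∀
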